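{- For every graph $G$ with minimum degree $\delta(G)$, $$\mathrm{pw}(L(G)) \geq \mathrm{tw}(L(G)) \geq \begin{cases} \frac{1}{4}\delta(G)^2+\delta(G)-1 & \text{when } \delta(G) \text{ is even},\\ \frac{1}{4}\delta(G)^2+\delta(G)-\frac{5}{4} & \text{when } \delta(G) \text{ is odd}.\end{cases}$$
   Context: Graphs are finite, simple and undirected, and $G$ has at least one vertex. The line graph $L(G)$ has vertex set $E(G)$, two distinct elements being adjacent if and only if the corresponding edges of $G$ share an endpoint. A tree decomposition of a graph $H$ is a (nonempty) tree $T$ together with a collection of subsets of $V(H)$ (bags) indexed by the nodes of $T$ such that: every vertex of $H$ is in at least one bag; for each vertex $v$ of $H$, the nodes whose bags contain $v$ induce a connected subtree of $T$; and for each edge of $H$ some bag contains both its endpoints. Its width is the size of the largest bag minus 1. The treewidth $\mathrm{tw}(H)$ is the minimum width of a tree decomposition of $H$; the pathwidth $\mathrm{pw}(H)$ is the minimum width over tree decompositions whose tree $T$ is a path. (If $H$ has no vertices, $\mathrm{tw}(H)=\mathrm{pw}(H)=-1$.) -}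

module Defs where

open import Data.Fin.Base using (Fin; zero; toℕ)
open import Data.Fin.Permutation using (Permutation′; _⟨$⟩ʳ_)
open import Data.Fin.Properties using (_≟_; _<?_; any?)
open import Data.Fin.Subset using (Subset; ∣_∣; _∈_)
open import Data.Integer.Base as ℤ using (ℤ; +_; 1ℤ)
open import Data.List.Base
  using (List; _∷_; _∷ʳ_; allFin; cartesianProduct; filter; length; lookup; tabulate)
open import Data.List.Extrema.Nat using (max; min)
open import Data.List.Relation.Unary.Linked using (Linked)
open import Data.List.Relation.Unary.Unique.Propositional using (Unique)
open import Data.Nat.Base as ℕ using (ℕ; NonZero)
open import Data.Product.Base using (∃-syntax; Σ-syntax; _×_; _,_)
open import Data.Sum.Base using (_⊎_)
import Data.Vec.Base as Vec
open import Function.Bundles using (_⇔_)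
open import Level using (Level; 0ℓ)
open import Relation.Binary.Construct.Closure.ReflexiveTransitive using (Star)
open import Relation.Binary.Core using (Rel)
open import Relation.Binary.Definitions using (Decidable; Irreflexive; Symmetric)
open import Relation.Binary.PropositionalEquality.Core using (_≡_; _≢_; sym)
open import Relation.Nullary.Decidable.Core using (does; ¬?; _×-dec_; _⊎-dec_)
open import Relation.Nullary.Negation.Core using (¬_)
open import Relation.Unary using (Pred; U)

private
  variable
    ℓ : Level
    n : ℕ

record Graph (n : ℕ) : Set₁ where
  field
    Adj    : Rel (Fin n) 0ℓ
    adj?   : Decidable Adj
    symm   : Symmetric Adj
    irrefl : Irreflexive _≡_ Adj

open Graph

neighbours : Graph n → Fin n → Subset n
neighbours G v = Vec.tabulate λ u → does (adj? G v u)

degree : Graph n → Fin n → ℕ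
degree G v = ∣ neighbours G v ∣

-- min d ds is the least element of d ∷ ds; here d is already among ds.
minDegree : Graph (ℕ.suc n) → ℕ
minDegree G = min (degree G zero) (tabulate (degree G))

-- Each edge is listed exactly once, as the pair of its endpoints in
-- increasing order.
edges : Graph n → List (Fin n × Fin n)
edges {n} G =
  filter (λ (u , v) → (u <? v) ×-dec adj? G u v) (cartesianProduct (allFin n) (allFin n))

EndpointOf : Fin n → Fin n × Fin n → Set
EndpointOf w (u , v) = w ≡ u ⊎ w ≡ v

ShareEndpoint : Rel (Fin n × Fin n) 0ℓ
ShareEndpoint e f = ∃[ w ] EndpointOf w e × EndpointOf w f

shareEndpoint? : Decidable (ShareEndpoint {n})
shareEndpoint? (u , v) (x , y) =
  any? λ w → ((w ≟ u) ⊎-dec (w ≟ v)) ×-dec ((w ≟ x) ⊎-dec (w ≟ y))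

-- Vertex i of the line graph stands for the i-th entry of edges G.
lineGraph : (G : Graph n) → Graph (length (edges G))
lineGraph G = record
  { Adj    = λ i j → i ≢ j × ShareEndpoint (edge i) (edge j)
  ; adj?   = λ i j → ¬? (i ≟ j) ×-dec shareEndpoint? (edge i) (edge j)
  ; symm   = λ (i≢j , w , p , q) → (λ j≡i → i≢j (sym j≡i)) , w , q , p
  ; irrefl = λ i≡j (i≢j , _) → i≢j i≡j
  }
  where edge = lookup (edges G)

-- The subgraph of G induced by P is connected.  The empty P is allowed.
InducesConnected : Graph n → Pred (Fin n) 0ℓ → Set
InducesConnected G P =
  ∀ {x y} → P x → P y → Star (λ a b → P a × P b × Adj G a b) x y

-- x ∷ xs are the distinct vertices of the cycle, in cyclic order.
IsCycle : Graph n → Fin n → List (Fin n) → Set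
IsCycle G x xs =
  Unique (x ∷ xs) × 2 ℕ.≤ length xs × Linked (Adj G) (x ∷ xs ∷ʳ x)

record IsTree {m : ℕ} (T : Graph m) : Set where
  field
    nonempty  : NonZero m
    connected : InducesConnected T U
    acyclic   : ∀ x xs → ¬ IsCycle T x xs

Consecutive : Rel (Fin n) 0ℓ
Consecutive i j = ℕ.suc (toℕ i) ≡ toℕ j ⊎ ℕ.suc (toℕ j) ≡ toℕ i

-- π x is the position of the node x along the path.
IsPath : {m : ℕ} → Graph m → Set
IsPath {m} T =
  Σ[ π ∈ Permutation′ m ] (∀ x y → Adj T x y ⇔ Consecutive (π ⟨$⟩ʳ x) (π ⟨$⟩ʳ y))

record TreeDecomposition (H : Graph n) : Set₁ where
  field
    {order}      : ℕ
    tree         : Graph order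
    isTree       : IsTree tree
    bag          : Fin order → Subset n
    coversVertex : ∀ v → ∃[ x ] v ∈ bag x
    -- Being an induced connected subgraph of a tree, and nonempty by
    -- coversVertex, this is a subtree.
    subtree      : ∀ v → InducesConnected tree (λ x → v ∈ bag x)
    coversEdge   : ∀ {u v} → Adj H u v → ∃[ x ] u ∈ bag x × v ∈ bag x

open TreeDecomposition

-- max 0 ds is the greatest element of 0 ∷ ds; the tree is nonempty, so the
-- extra 0 changes nothing.
width : {H : Graph n} → TreeDecomposition H → ℤ
width D = + max 0 (tabulate λ x → ∣ bag D x ∣) ℤ.- 1ℤ

IsMinimum : Pred ℤ ℓ → Pred ℤ ℓ
IsMinimum S k = S k × (∀ j → S j → k ℤ.≤ j)

-- IsTreewidth H k says that tw(H) = k; a graph without vertices has k = -1.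
IsTreewidth : Graph n → Pred ℤ (Level.suc 0ℓ)
IsTreewidth H = IsMinimum λ k → Σ[ D ∈ TreeDecomposition H ] width D ≡ k

IsPathwidth : Graph n → Pred ℤ (Level.suc 0ℓ)
IsPathwidth H = IsMinimum λ k →
  Σ[ D ∈ TreeDecomposition H ] IsPath (tree D) × width D ≡ k

{-# OPTIONS --safe #-}
module Submission where

-- For a vertex v the edges at v form a clique of L(G), so by the Helly property
-- of subtrees they share a bag, at a node home v.  If removing a tree edge xy
-- separates home u from home v, then an edge uv of G lies in the bags at x and
-- y.  Root the tree, put a = ⌊δ/2⌋, and take a deepest node x with more than
-- a homes at or below it.  The homes in the branches below x and the single
-- vertices with home x form sets of size at most a, and every edge leaving one
-- of these sets lies in the bag at x.  Uniting them one at a time until the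
-- size exceeds a yields X ⊆ W with |X| ≤ a < |W| ≤ |X| + a.  Each u in X has at
-- least δ + 1 - |X| neighbours outside X, and each u in W \ X at least
-- δ + 1 - |W| outside W; these edges are distinct and all lie in the bag at x.

open import Defs
open import Data.Nat.Base using (ℕ; suc)
open import Data.Nat.Divisibility using (_∣_; _∤_)
open import Data.Product.Base using (_×_)

open import Data.Fin.Base using (Fin; zero; suc)
open import Data.List.Base using (tabulate)
open import Data.List.Extrema.Nat using (max)
import Data.List.Relation.Unary.All as All
open import Data.Product.Base using (_,_; ∃-syntax; proj₁; proj₂)
open import Data.Sum.Base using (_⊎_; inj₁; inj₂)
open import Relation.Binary.PropositionalEquality
open import Relation.Nullary using (contradiction)

module TreesAndCuts where

  open import Data.Empty using (⊥-elim)
  open import Data.Fin.Properties using (_≟_; <-cmp; suc-injective)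
  open import Data.Fin.Subset using (Subset; inside; outside; _∈_; _∉_; _⊆_; ∣_∣; ⊤; ⊥; ⁅_⁆; _∪_; _-_)
  open import Data.Fin.Subset.Properties
    using ( _∈?_; nonempty?; Empty-unique; drop-there; p⊆q⇒∣p∣≤∣q∣; p⊂q⇒∣p∣<∣q∣; ∣p∣≤∣x∷p∣
          ; ∈⊤; ∣⊤∣≡n; ∉⊥; ⊥⊆; ∣⊥∣≡0; x∈⁅x⁆; x∈⁅y⁆⇒x≡y; ∣⁅x⁆∣≡1
          ; p⊆p∪q; x∈p∪q⁺; x∈p∪q⁻; p─q⊆p; x∈p∧x≢y⇒x∈p-y; x∈p⇒∣p-x∣<∣p∣ )
  open import Data.List.Base
    using (List; []; _∷_; _++_; _∷ʳ_; length; map; lookup; filter; allFin; cartesianProduct)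
  open import Data.List.Extrema.Nat
    using (argmin; argmin-all; f[argmin]≤f[xs]; argmax; argmax-all; f[xs]≤f[argmax]; xs≤max)
  import Data.List.Membership.DecPropositional as DecMembership
  open import Data.List.Membership.Propositional using (lose) renaming (_∈_ to _∈ˡ_; _∉_ to _∉ˡ_)
  open import Data.List.Membership.Propositional.Properties
    using ( ∈-allFin; ∈-filter⁺; ∈-filter⁻; ∈-++⁺ˡ; ∈-++⁺ʳ; ∈-++⁻; ∈-tabulate⁺
          ; ∈-cartesianProduct⁺; ∈-cartesianProduct⁻ )
  open import Data.List.Properties
    using (∷-injective; ∷-injectiveˡ; ∷-injectiveʳ; ≡-dec; filter-++; length-++; length-map)
  open import Data.List.Relation.Unary.All using (All; []; _∷_)
  import Data.List.Relation.Unary.All.Properties as All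
  open import Data.List.Relation.Unary.AllPairs using ([]; _∷_)
  open import Data.List.Relation.Unary.Any as Any using (Any; here; there)
  import Data.List.Relation.Unary.Any.Properties as Any
  open import Data.List.Relation.Unary.Linked using (Linked; [-]; _∷_)
  open import Data.List.Relation.Unary.Unique.Propositional using (Unique)
  import Data.List.Relation.Unary.Unique.Propositional.Properties as Unique
  open import Data.Nat.Base using (zero; _+_; _*_; _≤_; _<_; z≤n; s≤s)
  open import Data.Nat.Properties hiding (_≟_; <-cmp; suc-injective)
  open import Data.Nat.Tactic.RingSolver using (solve-∀)
  open import Data.Product.Base using (map₂; swap)
  open import Data.Sum.Base using ([_,_]′)
  open import Data.Vec.Base as Vec using ([]; _∷_; here; there)
  open import Data.Vec.Properties using (lookup∘tabulate; []=⇒lookup; lookup⇒[]=)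
  open import Function.Base using (_∘_; id)
  open import Level using (Level; 0ℓ)
  open import Relation.Binary.Construct.Closure.ReflexiveTransitive as Star using (Star; ε; _◅_; _◅◅_)
  open import Relation.Binary.Core using (Rel)
  open import Relation.Binary.Definitions using (tri<; tri≈; tri>)
  open import Relation.Nullary using (¬_; Dec; yes; no; does)
  open import Relation.Nullary.Decidable using (¬?; _×-dec_; _⊎-dec_; dec-true)
  open import Relation.Unary using (Pred; Decidable)

  open Graph

  private
    variable
      ℓ : Level
      A B : Set ℓ
      m n : ℕ
      T : Graph m
      ns : List (Fin m)

  -- Rooted trees

  -- The list holds the vertices after the start, so `x ∷ xs` is the whole walk, in the format of
  -- `IsCycle`.
  data SimpleWalk (R : Rel (Fin m) 0ℓ) : Fin m → List (Fin m) → Fin m → Set where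
    stop : ∀ {x} → SimpleWalk R x [] x
    step : ∀ {x y ys z} → R x y → All (x ≢_) (y ∷ ys) → SimpleWalk R y ys z → SimpleWalk R x (y ∷ ys) z

  module _ {R : Rel (Fin m) 0ℓ} where

    open DecMembership (_≟_ {m}) using () renaming (_∈?_ to _∈ˡ?_)

    walk-unique : ∀ {x xs z} → SimpleWalk R x xs z → Unique (x ∷ xs)
    walk-unique stop             = [] ∷ []
    walk-unique (step _ fresh w) = fresh ∷ walk-unique w

    walk-suffix : ∀ {x y ys z} → SimpleWalk R y ys z → x ∈ˡ y ∷ ys → ∃[ xs ] SimpleWalk R x xs z
    walk-suffix w            (here refl) = _ , w
    walk-suffix (step _ _ w) (there x∈)  = walk-suffix w x∈

    -- If the new first vertex already occurs on the loop-free remainder, the walk is cut down to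
    -- the suffix that starts there.
    loopErase : ∀ {x z} → Star R x z → ∃[ xs ] SimpleWalk R x xs z
    loopErase ε = [] , stop
    loopErase {x} (_◅_ {j = y} r rs) with ys , w ← loopErase rs with x ∈ˡ? y ∷ ys
    ... | yes x∈ = walk-suffix w x∈
    ... | no x∉  = y ∷ ys , step r (All.¬Any⇒All¬ _ x∉) w

  InducedAdj : Graph m → Pred (Fin m) 0ℓ → Rel (Fin m) 0ℓ
  InducedAdj T P a b = P a × P b × Adj T a b

  walk-inside : ∀ {P : Pred (Fin m) 0ℓ} {x xs z} →
    P x → SimpleWalk (InducedAdj T P) x xs z → All P (x ∷ xs)
  walk-inside         Px stop                    = Px ∷ []
  walk-inside {T = T} Px (step (_ , Py , _) _ w) = Px ∷ walk-inside {T = T} Py w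

  -- Otherwise a simple walk inside `P` from `a` to `z`, closed through `b`, is a cycle: `b` is new
  -- because it lies outside `P`, and `z ≢ a` yields the three vertices that `IsCycle` demands.
  acyclic⇒single-attachment : ∀ {P : Pred (Fin m) 0ℓ} →
    (∀ x xs → ¬ IsCycle T x xs) → InducesConnected T P →
    ∀ {a b z} → P a → ¬ P b → P z → Adj T a b → Adj T b z → z ≡ a
  acyclic⇒single-attachment {T = T} {P} acyclic conn {a} {b} {z} Pa ¬Pb Pz a~b b~z with z ≟ a
  ... | yes z≡a = z≡a
  ... | no  z≢a = ⊥-elim (acyclic b (a ∷ proj₁ walk) (unique , long (proj₂ walk) , linked))
    where
    walk = loopErase (conn Pa Pz)
    unique : Unique (b ∷ a ∷ proj₁ walk)
    unique = All.map (λ Px b≡x → ¬Pb (subst P (sym b≡x) Px)) (walk-inside {T = T} Pa (proj₂ walk))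
             ∷ walk-unique (proj₂ walk)
    long : ∀ {xs} → SimpleWalk (InducedAdj T P) a xs z → 2 ≤ length (a ∷ xs)
    long stop         = ⊥-elim (z≢a refl)
    long (step _ _ _) = s≤s (s≤s z≤n)
    close : ∀ {x xs} → SimpleWalk (InducedAdj T P) x xs z → Linked (Adj T) (x ∷ xs ∷ʳ b)
    close stop                   = symm T b~z ∷ [-]
    close (step (_ , _ , r) _ w) = r ∷ close w
    linked : Linked (Adj T) (b ∷ a ∷ proj₁ walk ∷ʳ b)
    linked = symm T a~b ∷ close (proj₂ walk)

  -- above x lists the proper ancestors of x, its parent first.
  record Rooting (T : Graph m) (ns : List (Fin m)) : Set where
    field
      root       : Fin m
      above      : Fin m → List (Fin m)
      connected  : InducesConnected T (_∈ˡ ns)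
      adjacent   : ∀ {x y} → x ∈ˡ ns → y ∈ˡ ns → Adj T x y →
                   above x ≡ y ∷ above y ⊎ above y ≡ x ∷ above x
      coherent   : ∀ {x} → x ∈ˡ ns → above x ≡ [] ⊎ ∃[ y ] y ∈ˡ ns × above x ≡ y ∷ above y
      root-above : ∀ {x} → x ∈ˡ ns → root ∈ˡ x ∷ above x

  rootAt : (T : Graph m) (r : Fin m) → Rooting T (r ∷ [])
  rootAt T r = record
    { root       = r
    ; above      = λ _ → []
    ; connected  = λ { (here refl) (here refl) → ε }
    ; adjacent   = λ { (here refl) (here refl) r~r → ⊥-elim (irrefl T refl r~r) }
    ; coherent   = λ _ → inj₁ refl
    ; root-above = λ { (here refl) → here refl }
    }

  -- The new node becomes a child of `a`. By `acyclic⇒single-attachment` it has no other neighbour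
  -- in `ns`, so every edge among the enlarged node set still joins a parent and a child.
  attach : (∀ x xs → ¬ IsCycle T x xs) → Rooting T ns →
    ∀ {a b} → a ∈ˡ ns → b ∉ˡ ns → Adj T a b → Rooting T (b ∷ ns)
  attach {m} {T} {ns} acyclic R {a} {b} a∈ b∉ a~b = record
    { root       = root
    ; above      = above′
    ; connected  = connected′
    ; adjacent   = adjacent′
    ; coherent   = coherent′
    ; root-above = root-above′
    }
    where
    open Rooting R
    above′ : Fin m → List (Fin m)
    above′ x with x ≟ b
    ... | yes _ = a ∷ above a
    ... | no  _ = above x
    above′-new : above′ b ≡ a ∷ above a
    above′-new with b ≟ b
    ... | yes _   = refl
    ... | no  b≢b = contradiction refl b≢b
    above′-old : ∀ {x} → x ∈ˡ ns → above′ x ≡ above x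
    above′-old {x} x∈ with x ≟ b
    ... | yes refl = contradiction x∈ b∉
    ... | no  _    = refl
    above′-child : above′ b ≡ a ∷ above′ a
    above′-child = trans above′-new (cong (a ∷_) (sym (above′-old a∈)))
    lift : ∀ {x y} → x ∈ˡ ns → y ∈ˡ ns → Star (InducedAdj T (_∈ˡ b ∷ ns)) x y
    lift x∈ y∈ = Star.map (λ (p , q , r) → there p , there q , r) (connected x∈ y∈)
    connected′ : InducesConnected T (_∈ˡ b ∷ ns)
    connected′ (here refl) (here refl) = ε
    connected′ (here refl) (there y∈)  = (here refl , there a∈ , symm T a~b) ◅ lift a∈ y∈
    connected′ (there x∈)  (here refl) = lift x∈ a∈ ◅◅ ((there a∈ , here refl , a~b) ◅ ε)
    connected′ (there x∈)  (there y∈)  = lift x∈ y∈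
    single : ∀ {z} → z ∈ˡ ns → Adj T b z → z ≡ a
    single z∈ = acyclic⇒single-attachment {T = T} acyclic connected a∈ b∉ z∈ a~b
    adjacent′ : ∀ {x y} → x ∈ˡ b ∷ ns → y ∈ˡ b ∷ ns → Adj T x y →
      above′ x ≡ y ∷ above′ y ⊎ above′ y ≡ x ∷ above′ x
    adjacent′ (here refl) (here refl) b~b = ⊥-elim (irrefl T refl b~b)
    adjacent′ (here refl) (there y∈)  b~y with refl ← single y∈ b~y = inj₁ above′-child
    adjacent′ (there x∈)  (here refl) x~b with refl ← single x∈ (symm T x~b) = inj₂ above′-child
    adjacent′ {x} {y} (there x∈) (there y∈) x~y
      rewrite above′-old x∈ | above′-old y∈ = adjacent x∈ y∈ x~y
    coherent′ : ∀ {x} → x ∈ˡ b ∷ ns → above′ x ≡ [] ⊎ ∃[ y ] y ∈ˡ b ∷ ns × above′ x ≡ y ∷ above′ y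
    coherent′ (here refl) = inj₂ (a , there a∈ , above′-child)
    coherent′ (there x∈) with coherent x∈
    ... | inj₁ eq            = inj₁ (trans (above′-old x∈) eq)
    ... | inj₂ (y , y∈ , eq) =
      inj₂ (y , there y∈ , trans (above′-old x∈) (trans eq (cong (y ∷_) (sym (above′-old y∈)))))
    root-above′ : ∀ {x} → x ∈ˡ b ∷ ns → root ∈ˡ x ∷ above′ x
    root-above′ (here refl) rewrite above′-new = there (root-above a∈)
    root-above′ (there x∈)  rewrite above′-old x∈ = root-above x∈

  module _ {m : ℕ} {T : Graph (suc m)} (isTree : IsTree T) where

    open IsTree isTree
    open DecMembership (_≟_ {suc m}) using () renaming (_∈?_ to _∈ˡ?_)

    private
      Grown : List (Fin (suc m)) → Pred (List (Fin (suc m))) 0ℓ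
      Grown ns ns′ = (∀ {x} → x ∈ˡ ns → x ∈ˡ ns′) × Rooting T ns′

    -- The walk is followed node by node; a node not yet rooted is attached below its predecessor on
    -- the walk.
    growAlong : ∀ {a w ns} → Rooting T ns → a ∈ˡ ns → Star (Adj T) a w →
      ∃[ ns′ ] (w ∈ˡ ns′ × Grown ns ns′)
    growAlong R a∈ ε = _ , a∈ , (λ x∈ → x∈) , R
    growAlong {ns = ns} R a∈ (_◅_ {j = b} a~b bs) with b ∈ˡ? ns
    ... | yes b∈ = growAlong R b∈ bs
    ... | no  b∉ with ns′ , w∈ , ⊆ , R′ ← growAlong (attach acyclic R a∈ b∉ a~b) (here refl) bs =
      ns′ , w∈ , ⊆ ∘ there , R′

    growOver : ∀ {a ns} → Rooting T ns → a ∈ˡ ns → (ws : List (Fin (suc m))) →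
      ∃[ ns′ ] (All (_∈ˡ ns′) ws × Grown ns ns′)
    growOver R a∈ [] = _ , [] , (λ x∈ → x∈) , R
    growOver {a} R a∈ (w ∷ ws)
      with ns₁ , w∈ , ⊆₁ , R₁ ← growAlong R a∈ (Star.map (proj₂ ∘ proj₂) (connected {a} {w} _ _))
      with ns₂ , ws∈ , ⊆₂ , R₂ ← growOver R₁ (⊆₁ a∈) ws =
      ns₂ , ⊆₂ w∈ ∷ ws∈ , ⊆₂ ∘ ⊆₁ , R₂

    rooting⁺ : ∃[ ns ] ((∀ x → x ∈ˡ ns) × Rooting T ns)
    rooting⁺ with ns , all∈ , _ , R ← growOver (rootAt T zero) (here refl) (allFin (suc m)) =
      ns , (λ x → All.lookup all∈ (∈-allFin x)) , R

  rooting : {T : Graph m} → IsTree T → ∃[ ns ] ((∀ x → x ∈ˡ ns) × Rooting T ns)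
  rooting {m = 0}     isTree with () ← IsTree.nonempty isTree
  rooting {m = suc _} isTree = rooting⁺ isTree

  least : (f : A → ℕ) {a : A} {xs : List A} → a ∈ˡ xs →
    ∃[ x ] x ∈ˡ xs × (∀ {y} → y ∈ˡ xs → f x ≤ f y)
  least f {a} {xs} a∈ =
    argmin f a xs , argmin-all f a∈ (All.tabulate id) , All.lookup (f[argmin]≤f[xs] a xs)

  greatest : (f : A → ℕ) {a : A} {xs : List A} → a ∈ˡ xs →
    ∃[ x ] x ∈ˡ xs × (∀ {y} → y ∈ˡ xs → f y ≤ f x)
  greatest f {a} {xs} a∈ =
    argmax f a xs , argmax-all f a∈ (All.tabulate id) , All.lookup (f[xs]≤f[argmax] a xs)

  comprehension : {P : Pred (Fin n) ℓ} → Decidable P → Subset n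
  comprehension P? = Vec.tabulate (does ∘ P?)

  module _ {P : Pred (Fin n) ℓ} (P? : Decidable P) where

    ∈-comprehension⁺ : ∀ {x} → P x → x ∈ comprehension P?
    ∈-comprehension⁺ {x} Px =
      lookup⇒[]= x _ (trans (lookup∘tabulate (does ∘ P?) x) (dec-true (P? x) Px))

    ∈-comprehension⁻ : ∀ {x} → x ∈ comprehension P? → P x
    ∈-comprehension⁻ {x} x∈ with P? x | trans (sym (lookup∘tabulate (does ∘ P?) x)) ([]=⇒lookup x∈)
    ... | yes Px | _ = Px
    ... | no  _  | ()

  -- Ancestors, the Helly property and balanced nodes

  module RootedTree {m} {T : Graph m} {ns} (R : Rooting T ns) (all∈ : ∀ x → x ∈ˡ ns) where

    open Rooting R
    open DecMembership (_≟_ {m}) using () renaming (_∈?_ to _∈ˡ?_)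

    infix 4 _⊴_ _⊴?_ _ChildOf_

    _⊴_ : Rel (Fin m) 0ℓ
    c ⊴ x = c ∈ˡ x ∷ above x

    _⊴?_ : ∀ c x → Dec (c ⊴ x)
    c ⊴? x = c ∈ˡ? x ∷ above x

    _ChildOf_ : Rel (Fin m) 0ℓ
    c ChildOf x = above c ≡ x ∷ above x

    depth : Fin m → ℕ
    depth x = length (above x)

    above-∷ : ∀ {x y ys} → above x ≡ y ∷ ys → x ChildOf y × above y ≡ ys
    above-∷ {x} eq with coherent (all∈ x)
    ... | inj₁ eq′ with () ← trans (sym eq) eq′
    ... | inj₂ (_ , _ , eq′) with refl , refl ← ∷-injective (trans (sym eq) eq′) = eq′ , refl

    -- The list `ys` stands for `above x` so that the induction can pass to its tail, which is the
    -- ancestor list of the parent.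
    above-depth : ∀ {c x ys} → above x ≡ ys → c ∈ˡ ys → depth c < length ys
    above-depth eq (here refl) = s≤s (≤-reflexive (cong length (proj₂ (above-∷ eq))))
    above-depth eq (there c∈)  = m<n⇒m<1+n (above-depth (proj₂ (above-∷ eq)) c∈)

    ⊴-depth : ∀ {c x} → c ⊴ x → c ≢ x → depth c < depth x
    ⊴-depth (here c≡x) c≢x = contradiction c≡x c≢x
    ⊴-depth (there c∈) _   = above-depth refl c∈

    -- The child is the entry just before `x` on the way up from `v`; it names the branch at `x`
    -- that contains `v`.
    above-child : ∀ {x v ys} → above v ≡ ys → x ∈ˡ ys → ∃[ c ] c ChildOf x × c ⊴ v
    above-child {v = v} eq (here refl) = v , proj₁ (above-∷ eq) , here refl
    above-child eq (there x∈)
      with v-child , eq′ ← above-∷ eq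
      with c , c-child , c⊴y ← above-child eq′ x∈ =
      c , c-child , there (subst (c ∈ˡ_) (sym v-child) c⊴y)

    -- Every edge joins a parent and a child, so the only step that leaves the nodes at or below `c`
    -- is the one from `c` to its parent, and a path inside `P` that leaves them visits that parent.
    crossing : ∀ {P : Pred (Fin m) 0ℓ} {c i j} → Star (InducedAdj T P) i j →
      c ⊴ i → ¬ c ⊴ j → ∃[ y ] P y × c ChildOf y
    crossing ε c⊴i c⋬i = contradiction c⊴i c⋬i
    crossing {c = c} (_◅_ {i = i} {j = k} (_ , Pk , i~k) path) c⊴i c⋬j with c ⊴? k
    ... | yes c⊴k = crossing path c⊴k c⋬j
    ... | no  c⋬k with adjacent (all∈ i) (all∈ k) i~k | c⊴i
    ... | inj₁ eq | here refl = k , Pk , eq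
    ... | inj₁ eq | there c∈  = contradiction (subst (c ∈ˡ_) eq c∈) c⋬k
    ... | inj₂ eq | _         = contradiction (there (subst (c ∈ˡ_) (sym eq) c⊴i)) c⋬k

    IsTop : Pred (Fin m) 0ℓ → Fin m → Set
    IsTop P t = P t × (∀ {y} → P y → depth t ≤ depth y)

    -- The path from `z` to `t` has to leave the nodes below `z`: if `z ⊴ t`, then `z` would be
    -- strictly higher than the top.
    parent-inside : ∀ {P : Pred (Fin m) 0ℓ} {t z} → InducesConnected T P → IsTop P t → P z → z ≢ t →
      ∃[ y ] P y × z ChildOf y
    parent-inside conn (Pt , t-top) Pz z≢t =
      crossing (conn Pz Pt) (here refl) (λ z⊴t → ≤⇒≯ (t-top Pz) (⊴-depth z⊴t z≢t))

    -- Starting at a common node and climbing, each parent is again common to `P` and `Q` until `t`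
    -- is reached. This is the core of the Helly property: of two subtrees that meet, one contains
    -- the top of the other.
    deeper-top-shared : ∀ {P Q : Pred (Fin m) 0ℓ} {t u} →
      InducesConnected T P → InducesConnected T Q →
      IsTop P t → IsTop Q u → depth u ≤ depth t → ∀ {z} → P z → Q z → Q t
    deeper-top-shared {P} {Q} {t} {u} P-conn Q-conn P-top Q-top u≤t {z₀} Pz₀ Qz₀ =
      climb (above z₀) refl Pz₀ Qz₀
      where
      common-parent : ∀ {z} → P z → Q z → z ≢ t → ∃[ y ] P y × Q y × z ChildOf y
      common-parent {z} Pz Qz z≢t with y , Py , z-child ← parent-inside P-conn P-top Pz z≢t =
        y , Py , subst Q y′≡y (proj₁ (proj₂ Q-parent)) , z-child
        where
        -- If `z` were the top of `Q`, its parent, which lies in `P`, would be higher than `u` and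
        -- hence higher than `t`.
        z≢u : z ≢ u
        z≢u refl = contradiction (proj₂ P-top Py)
          (<⇒≱ (<-≤-trans (≤-reflexive (sym (cong length z-child))) u≤t))
        Q-parent = parent-inside Q-conn Q-top Qz z≢u
        y′≡y : proj₁ Q-parent ≡ y
        y′≡y = ∷-injectiveˡ (trans (sym (proj₂ (proj₂ Q-parent))) z-child)
      climb : ∀ ys {z} → above z ≡ ys → P z → Q z → Q t
      climb ys {z} eq Pz Qz with z ≟ t
      climb ys       eq Pz Qz | yes refl = Qz
      climb []       eq Pz Qz | no  z≢t with _ , _ , _ , z-child ← common-parent Pz Qz z≢t
        with () ← trans (sym eq) z-child
      climb (_ ∷ ys) eq Pz Qz | no  z≢t with y , Py , Qy , z-child ← common-parent Pz Qz z≢t =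
        climb ys (sym (∷-injectiveʳ (trans (sym eq) z-child))) Py Qy

    top : ∀ {P : Pred (Fin m) 0ℓ} → Decidable P → ∀ {x} → P x → ∃[ t ] IsTop P t
    top P? {x} Px with t , t∈ , min ← least depth (∈-filter⁺ P? (∈-allFin x) Px) =
      t , proj₂ (∈-filter⁻ P? {xs = allFin m} t∈) , λ {y} Py → min (∈-filter⁺ P? (∈-allFin y) Py)

    module _ {I : Set} {P : I → Pred (Fin m) 0ℓ} (conn : ∀ i → InducesConnected T (P i)) where

      -- The deepest of all tops works: by `deeper-top-shared` it lies in every member of the
      -- family.
      shared-top : (apex : I → Fin m) → (∀ i → IsTop (P i) (apex i)) → ∀ {i₀ is} → i₀ ∈ˡ is →
        (∀ {i j} → i ∈ˡ is → j ∈ˡ is → ∃[ x ] P i x × P j x) →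
        ∃[ x ] (∀ {i} → i ∈ˡ is → P i x)
      shared-top apex apex-top i₀∈ meet with k , k∈ , deepest ← greatest (depth ∘ apex) i₀∈ =
        apex k , λ {i} i∈ → let _ , Pkz , Piz = meet k∈ i∈ in
          deeper-top-shared (conn k) (conn i) (apex-top k) (apex-top i) (deepest i∈) Pkz Piz

      helly : (∀ i → Decidable (P i)) → (∀ i → ∃[ x ] P i x) → ∀ {i₀ is} → i₀ ∈ˡ is →
        (∀ {i j} → i ∈ˡ is → j ∈ˡ is → ∃[ x ] P i x × P j x) →
        ∃[ x ] (∀ {i} → i ∈ˡ is → P i x)
      helly P? inhabited =
        shared-top
          (λ i → proj₁ (top (P? i) (proj₂ (inhabited i))))
          (λ i → proj₂ (top (P? i) (proj₂ (inhabited i))))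

    module _ {n} (home : Fin n → Fin m) where

      below : Fin m → Subset n
      below c = comprehension (λ v → c ⊴? home v)

      -- Take a deepest node with more than `a` homes at or below it. The root qualifies because all
      -- `n` homes are at or below it, and a child is deeper than its parent, so no child of the
      -- chosen node qualifies.
      balancedNode : ∀ {a} → a < n →
        ∃[ x ] a < ∣ below x ∣ × (∀ {c} → c ChildOf x → ∣ below c ∣ ≤ a)
      balancedNode {a} a<n = x , proj₂ (∈-filter⁻ heavy? {xs = allFin m} (proj₁ (proj₂ choice))) ,
        λ {c} c-child → ≮⇒≥ λ c-heavy → <⇒≱ (≤-reflexive (sym (cong length c-child)))
          (proj₂ (proj₂ choice) (∈-filter⁺ heavy? (∈-allFin c) c-heavy))
        where
        heavy? : Decidable (λ x → a < ∣ below x ∣)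
        heavy? x = a <? ∣ below x ∣
        root-heavy : a < ∣ below root ∣
        root-heavy = <-≤-trans a<n (subst (_≤ ∣ below root ∣) (∣⊤∣≡n n)
          (p⊆q⇒∣p∣≤∣q∣ {p = ⊤} λ {v} _ →
            ∈-comprehension⁺ (λ v → root ⊴? home v) (root-above (all∈ (home v)))))
        choice = greatest depth (∈-filter⁺ heavy? (∈-allFin root) root-heavy)
        x = proj₁ choice

  -- Counting edges across cuts

  filter-map : {P : Pred B ℓ} (P? : Decidable P) (f : A → B) (xs : List A) →
    filter P? (map f xs) ≡ map f (filter (P? ∘ f) xs)
  filter-map P? f []       = refl
  filter-map P? f (x ∷ xs) with P? (f x)
  ... | yes _ = cong (f x ∷_) (filter-map P? f xs)
  ... | no  _ = filter-map P? f xs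

  length-filter-cartesianProduct : {P : Pred (A × B) ℓ} (P? : Decidable P) {k : ℕ}
    (xs : List A) (ys : List B) →
    (∀ {x} → x ∈ˡ xs → k ≤ length (filter (λ y → P? (x , y)) ys)) →
    length xs * k ≤ length (filter P? (cartesianProduct xs ys))
  length-filter-cartesianProduct P? []       ys _    = z≤n
  length-filter-cartesianProduct P? {k} (x ∷ xs) ys rows = begin
    k + length xs * k
      ≤⟨ +-mono-≤ (rows (here refl)) (length-filter-cartesianProduct P? xs ys (rows ∘ there)) ⟩
    length (filter (λ y → P? (x , y)) ys) + length (filter P? rest)
      ≡⟨ cong (_+ _) (trans (cong length (filter-map P? (x ,_) ys))
                            (length-map (x ,_) (filter (λ y → P? (x , y)) ys))) ⟨
    length (filter P? (map (x ,_) ys)) + length (filter P? rest)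
      ≡⟨ length-++ (filter P? (map (x ,_) ys)) ⟨
    length (filter P? (map (x ,_) ys) ++ filter P? rest)
      ≡⟨ cong length (filter-++ P? (map (x ,_) ys) rest) ⟨
    length (filter P? (map (x ,_) ys ++ rest))
      ∎
    where
    open ≤-Reasoning
    rest = cartesianProduct xs ys

  -- The injection is a relation because `Joins` will match a pair with an index in either
  -- orientation. Deleting the partner of the first entry from `p` leaves the partners of the
  -- others, by injectivity.
  length≤∣p∣ : {A : Set ℓ} (_~_ : A → Fin n → Set) {xs : List A} {p : Subset n} → Unique xs →
    (∀ {x} → x ∈ˡ xs → ∃[ i ] i ∈ p × x ~ i) →
    (∀ {x y i} → x ∈ˡ xs → y ∈ˡ xs → x ~ i → y ~ i → x ≡ y) →
    length xs ≤ ∣ p ∣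
  length≤∣p∣ _~_ [] _ _ = z≤n
  length≤∣p∣ _~_ {x ∷ xs} {p} (x∉xs ∷ unique) total injective with i , i∈p , x~i ← total (here refl) =
    ≤-<-trans
      (length≤∣p∣ _~_ {p = p - i} unique total′ λ y∈ z∈ → injective (there y∈) (there z∈))
      (x∈p⇒∣p-x∣<∣p∣ i∈p)
    where
    total′ : ∀ {y} → y ∈ˡ xs → ∃[ j ] j ∈ p - i × y ~ j
    total′ {y} y∈ with j , j∈p , y~j ← total (there y∈) =
      j , x∈p∧x≢y⇒x∈p-y j∈p j≢i , y~j
      where
      j≢i : j ≢ i
      j≢i refl = All.lookup x∉xs y∈ (injective (here refl) (there y∈) x~i y~j)

  x∉p-x : (p : Subset n) (x : Fin n) → x ∉ p - x
  x∉p-x (_ ∷ p) (suc x) (there x∈) = x∉p-x p x x∈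

  p⊆x∪q⇒∣p∣≤1+∣q∣ : (p q : Subset n) (x : Fin n) →
    (∀ {y} → y ∈ p → y ≢ x → y ∈ q) → ∣ p ∣ ≤ suc ∣ q ∣
  p⊆x∪q⇒∣p∣≤1+∣q∣ (s ∷ p) (t ∷ q) zero sub = begin
    ∣ s ∷ p ∣    ≤⟨ ∣s∷p∣≤ s ⟩
    suc ∣ p ∣    ≤⟨ s≤s (p⊆q⇒∣p∣≤∣q∣ λ y∈ → drop-there (sub (there y∈) λ ())) ⟩
    suc ∣ q ∣    ≤⟨ s≤s (∣p∣≤∣x∷p∣ t q) ⟩
    suc ∣ t ∷ q ∣ ∎
    where
    open ≤-Reasoning
    ∣s∷p∣≤ : ∀ s → ∣ s ∷ p ∣ ≤ suc ∣ p ∣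
    ∣s∷p∣≤ inside  = ≤-refl
    ∣s∷p∣≤ outside = n≤1+n _
  p⊆x∪q⇒∣p∣≤1+∣q∣ (outside ∷ p) (t ∷ q) (suc x) sub = ≤-trans
    (p⊆x∪q⇒∣p∣≤1+∣q∣ p q x λ y∈ y≢x → drop-there (sub (there y∈) (y≢x ∘ suc-injective)))
    (s≤s (∣p∣≤∣x∷p∣ t q))
  -- Position zero is not `suc x`, so `sub` forces `t` to be `inside`.
  p⊆x∪q⇒∣p∣≤1+∣q∣ (inside ∷ p) (t ∷ q) (suc x) sub with here ← sub here (λ ()) =
    s≤s (p⊆x∪q⇒∣p∣≤1+∣q∣ p q x λ y∈ y≢x → drop-there (sub (there y∈) (y≢x ∘ suc-injective)))

  ∣p∣≤length : {p : Subset n} (xs : List (Fin n)) → (∀ {x} → x ∈ p → x ∈ˡ xs) → ∣ p ∣ ≤ length xs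
  ∣p∣≤length {n} [] p⊆xs with refl ← Empty-unique (λ (_ , x∈p) → contradiction (p⊆xs x∈p) λ ()) =
    ≤-reflexive (∣⊥∣≡0 n)
  ∣p∣≤length {p = p} (x ∷ xs) p⊆xs =
    ≤-trans (p⊆x∪q⇒∣p∣≤1+∣q∣ p (p - x) x x∈p∧x≢y⇒x∈p-y) (s≤s (∣p∣≤length xs p-x⊆xs))
    where
    p-x⊆xs : ∀ {y} → y ∈ p - x → y ∈ˡ xs
    p-x⊆xs {y} y∈ with p⊆xs (p─q⊆p p ⁅ x ⁆ y∈)
    ... | here refl = contradiction y∈ (x∉p-x p x)
    ... | there y∈xs = y∈xs

  elements : Subset n → List (Fin n)
  elements {n} p = filter (_∈? p) (allFin n)

  ∈-elements⁺ : {p : Subset n} → ∀ {x} → x ∈ p → x ∈ˡ elements p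
  ∈-elements⁺ {p = p} {x} x∈p = ∈-filter⁺ (_∈? p) (∈-allFin x) x∈p

  ∈-elements⁻ : (p : Subset n) → ∀ {x} → x ∈ˡ elements p → x ∈ p
  ∈-elements⁻ {n} p x∈ = proj₂ (∈-filter⁻ (_∈? p) {xs = allFin n} x∈)

  ∣elements∣ : (p : Subset n) → length (elements p) ≤ ∣ p ∣
  ∣elements∣ {n} p = length≤∣p∣ _≡_ (Unique.filter⁺ (_∈? p) (Unique.allFin⁺ n))
    (λ {x} x∈ → x , ∈-elements⁻ p x∈ , refl) (λ _ _ eq eq′ → trans eq (sym eq′))

  module _ (G : Graph n) where

    -- Both orientations are allowed: `edges` keeps only the increasing one, whereas the pairs
    -- counted below point out of a set.
    Joins : Fin n × Fin n → Fin (length (edges G)) → Set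
    Joins uv i = lookup (edges G) i ≡ uv ⊎ lookup (edges G) i ≡ swap uv

    Joins-unique : ∀ {d e i} → Joins d i → Joins e i → d ≡ e ⊎ d ≡ swap e
    Joins-unique (inj₁ p) (inj₁ q) = inj₁ (trans (sym p) q)
    Joins-unique (inj₁ p) (inj₂ q) = inj₂ (trans (sym p) q)
    Joins-unique (inj₂ p) (inj₁ q) = inj₂ (cong swap (trans (sym p) q))
    Joins-unique (inj₂ p) (inj₂ q) = inj₁ (cong swap (trans (sym p) q))

    adjacent⇒joined : ∀ {u v} → Adj G u v → ∃[ i ] Joins (u , v) i
    adjacent⇒joined {u} {v} u~v with <-cmp u v
    ... | tri≈ _ u≡v _ = ⊥-elim (irrefl G u≡v u~v)
    ... | tri< u<v _ _ = Any.index uv∈ , inj₁ (sym (Any.lookup-index uv∈))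
      where
      uv∈ : (u , v) ∈ˡ edges G
      uv∈ = ∈-filter⁺ _ (∈-cartesianProduct⁺ (∈-allFin u) (∈-allFin v)) (u<v , u~v)
    ... | tri> _ _ v<u = Any.index vu∈ , inj₂ (sym (Any.lookup-index vu∈))
      where
      vu∈ : (v , u) ∈ˡ edges G
      vu∈ = ∈-filter⁺ _ (∈-cartesianProduct⁺ (∈-allFin v) (∈-allFin u)) (v<u , symm G u~v)

    leaving : Fin n → Subset n → List (Fin n)
    leaving u W = filter (λ v → adj? G u v ×-dec ¬? (v ∈? W)) (allFin n)

    -- A neighbour of `u` lies outside `W` or in `W - u`; the inequality is strict because `u`
    -- itself is in `W`.
    degree-leaving : ∀ {u W} → u ∈ W → degree G u < length (leaving u W) + ∣ W ∣
    degree-leaving {u} {W} u∈W = begin-strict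
      degree G u                                        ≤⟨ ∣p∣≤length (leaving u W ++ elements (W - u)) split ⟩
      length (leaving u W ++ elements (W - u))          ≡⟨ length-++ (leaving u W) ⟩
      length (leaving u W) + length (elements (W - u))  ≤⟨ +-monoʳ-≤ (length (leaving u W)) (∣elements∣ (W - u)) ⟩
      length (leaving u W) + ∣ W - u ∣                  <⟨ +-monoʳ-< (length (leaving u W)) (x∈p⇒∣p-x∣<∣p∣ u∈W) ⟩
      length (leaving u W) + ∣ W ∣                      ∎
      where
      open ≤-Reasoning
      split : ∀ {v} → v ∈ neighbours G u → v ∈ˡ leaving u W ++ elements (W - u)
      split {v} v∈ with u~v ← ∈-comprehension⁻ (adj? G u) v∈ | v ∈? W
      ... | no  v∉W = ∈-++⁺ˡ (∈-filter⁺ _ (∈-allFin v) (u~v , v∉W))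
      ... | yes v∈W = ∈-++⁺ʳ (leaving u W) (∈-elements⁺ (x∈p∧x≢y⇒x∈p-y v∈W λ v≡u → irrefl G (sym v≡u) u~v))

    degree<n : ∀ u → degree G u < n
    degree<n u = subst (degree G u <_) (∣⊤∣≡n n)
      (p⊂q⇒∣p∣<∣q∣ ((λ _ → ∈⊤) , u , ∈⊤ , irrefl G refl ∘ ∈-comprehension⁻ (adj? G u)))

    ContainsCut : Subset (length (edges G)) → Subset n → Set
    ContainsCut B P = ∀ u v i → u ∈ P → v ∉ P → Joins (u , v) i → i ∈ B

    module _ {B : Subset (length (edges G))} {X W : Subset n} (X⊆W : X ⊆ W)
             (cutX : ContainsCut B X) (cutW : ContainsCut B W) where

      private
        Out : Subset n → Fin n × Fin n → Set
        Out P (u , v) = Adj G u v × v ∉ P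

        out? : ∀ P → Decidable (Out P)
        out? P (u , v) = adj? G u v ×-dec ¬? (v ∈? P)

        new? : Decidable (λ u → u ∈ W × u ∉ X)
        new? u = (u ∈? W) ×-dec ¬? (u ∈? X)

        newcomers : List (Fin n)
        newcomers = filter new? (allFin n)

        -- Edges directed outwards: those leaving `X`, and those leaving `W` from a vertex of `W`
        -- outside `X`. The starting points keep the two lists disjoint.
        outX outW : List (Fin n × Fin n)
        outX = filter (out? X) (cartesianProduct (elements X) (allFin n))
        outW = filter (out? W) (cartesianProduct newcomers (allFin n))

        ∈-outX⁻ : ∀ {u v} → (u , v) ∈ˡ outX → u ∈ X × Adj G u v × v ∉ X
        ∈-outX⁻ d∈
          with d∈′ , u~v , v∉X ←
            ∈-filter⁻ (out? X) {xs = cartesianProduct (elements X) (allFin n)} d∈ =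
          ∈-elements⁻ X (proj₁ (∈-cartesianProduct⁻ (elements X) (allFin n) d∈′)) , u~v , v∉X

        ∈-outW⁻ : ∀ {u v} → (u , v) ∈ˡ outW → (u ∈ W × u ∉ X) × Adj G u v × v ∉ W
        ∈-outW⁻ d∈
          with d∈′ , u~v , v∉W ←
            ∈-filter⁻ (out? W) {xs = cartesianProduct newcomers (allFin n)} d∈ =
          proj₂ (∈-filter⁻ new? {xs = allFin n}
            (proj₁ (∈-cartesianProduct⁻ newcomers (allFin n) d∈′))) , u~v , v∉W

        unique : Unique (outX ++ outW)
        unique = Unique.++⁺
          (Unique.filter⁺ (out? X) (Unique.cartesianProduct⁺
            (Unique.filter⁺ (_∈? X) (Unique.allFin⁺ n)) (Unique.allFin⁺ n)))
          (Unique.filter⁺ (out? W) (Unique.cartesianProduct⁺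
            (Unique.filter⁺ new? (Unique.allFin⁺ n)) (Unique.allFin⁺ n)))
          λ (d∈X , d∈W) → proj₂ (proj₁ (∈-outW⁻ d∈W)) (proj₁ (∈-outX⁻ d∈X))

        joinedInB : ∀ {d} → d ∈ˡ outX ++ outW → ∃[ i ] i ∈ B × Joins d i
        joinedInB d∈ with ∈-++⁻ outX d∈
        ... | inj₁ d∈X with u∈X , u~v , v∉X ← ∈-outX⁻ d∈X with i , joins ← adjacent⇒joined u~v =
          i , cutX _ _ i u∈X v∉X joins , joins
        ... | inj₂ d∈W with (u∈W , _) , u~v , v∉W ← ∈-outW⁻ d∈W with i , joins ← adjacent⇒joined u~v =
          i , cutW _ _ i u∈W v∉W joins , joins

        -- A pair starts inside the set that it leaves. In the mixed cases the start of the `outX`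
        -- pair lies in `X ⊆ W`, while the reversed pair would end outside `W`. So no edge is
        -- counted in both directions.
        one-way : ∀ {u v} → (u , v) ∈ˡ outX ++ outW → ¬ (v , u) ∈ˡ outX ++ outW
        one-way d∈ e∈ with ∈-++⁻ outX d∈ | ∈-++⁻ outX e∈
        ... | inj₁ d∈X | inj₁ e∈X = proj₂ (proj₂ (∈-outX⁻ d∈X)) (proj₁ (∈-outX⁻ e∈X))
        ... | inj₁ d∈X | inj₂ e∈W = proj₂ (proj₂ (∈-outW⁻ e∈W)) (X⊆W (proj₁ (∈-outX⁻ d∈X)))
        ... | inj₂ d∈W | inj₁ e∈X = proj₂ (proj₂ (∈-outW⁻ d∈W)) (X⊆W (proj₁ (∈-outX⁻ e∈X)))
        ... | inj₂ d∈W | inj₂ e∈W = proj₂ (proj₂ (∈-outW⁻ d∈W)) (proj₁ (proj₁ (∈-outW⁻ e∈W)))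

        distinct : ∀ {d e i} → d ∈ˡ outX ++ outW → e ∈ˡ outX ++ outW → Joins d i → Joins e i → d ≡ e
        distinct d∈ e∈ p q with Joins-unique p q
        ... | inj₁ d≡e  = d≡e
        ... | inj₂ refl = contradiction d∈ (one-way e∈)

      -- By `degree-leaving`, each vertex of `X` starts at least `k` pairs of `outX`, and each of
      -- the at least `q` newcomers starts at least `l` pairs of `outW`; distinct pairs join
      -- distinct members of `B`. The additive hypotheses on `k`, `l` and `q` avoid truncated
      -- subtraction.
      two-cuts-bound : ∀ {δ k l q} → (∀ u → δ ≤ degree G u) →
        k + ∣ X ∣ ≤ suc δ → l + ∣ W ∣ ≤ suc δ → q + ∣ X ∣ ≤ ∣ W ∣ → ∣ X ∣ * k + q * l ≤ ∣ B ∣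
      two-cuts-bound {δ} {k} {l} {q} δ≤ k+X≤ l+W≤ q+X≤ = begin
        ∣ X ∣ * k + q * l
          ≤⟨ +-mono-≤ (*-monoˡ-≤ k (∣p∣≤length (elements X) ∈-elements⁺)) (*-monoˡ-≤ l q≤) ⟩
        length (elements X) * k + length newcomers * l
          ≤⟨ +-mono-≤
               (length-filter-cartesianProduct (out? X) (elements X) (allFin n) (leave k+X≤ ∘ ∈-elements⁻ X))
               (length-filter-cartesianProduct (out? W) newcomers (allFin n)
                 λ u∈ → leave l+W≤ (proj₁ (proj₂ (∈-filter⁻ new? {xs = allFin n} u∈)))) ⟩
        length outX + length outW
          ≡⟨ length-++ outX ⟨
        length (outX ++ outW)
          ≤⟨ length≤∣p∣ Joins unique joinedInB distinct ⟩
        ∣ B ∣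
          ∎
        where
        open ≤-Reasoning
        leave : ∀ {u P r} → r + ∣ P ∣ ≤ suc δ → u ∈ P → r ≤ length (leaving u P)
        leave {u} {P} {r} r+P≤ u∈P = +-cancelʳ-≤ (∣ P ∣) r (length (leaving u P))
          (≤-trans r+P≤ (≤-<-trans (δ≤ u) (degree-leaving u∈P)))
        W⊆ : ∀ {u} → u ∈ W → u ∈ˡ newcomers ++ elements X
        W⊆ {u} u∈W with u ∈? X
        ... | yes u∈X = ∈-++⁺ʳ newcomers (∈-elements⁺ u∈X)
        ... | no  u∉X = ∈-++⁺ˡ (∈-filter⁺ new? (∈-allFin u) (u∈W , u∉X))
        q≤ : q ≤ length newcomers
        q≤ = +-cancelʳ-≤ (∣ X ∣) q (length newcomers) (≤-trans q+X≤ (begin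
          ∣ W ∣                                    ≤⟨ ∣p∣≤length (newcomers ++ elements X) W⊆ ⟩
          length (newcomers ++ elements X)         ≡⟨ length-++ newcomers ⟩
          length newcomers + length (elements X)   ≤⟨ +-monoʳ-≤ (length newcomers) (∣elements∣ X) ⟩
          length newcomers + ∣ X ∣                 ∎))

  -- Straddling unions and their arithmetic

  ∣p∪q∣≤∣p∣+∣q∣ : (p q : Subset n) → ∣ p ∪ q ∣ ≤ ∣ p ∣ + ∣ q ∣
  ∣p∪q∣≤∣p∣+∣q∣ p q = begin
    ∣ p ∪ q ∣                                   ≤⟨ ∣p∣≤length (elements p ++ elements q) sub ⟩
    length (elements p ++ elements q)           ≡⟨ length-++ (elements p) ⟩
    length (elements p) + length (elements q)   ≤⟨ +-mono-≤ (∣elements∣ p) (∣elements∣ q) ⟩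
    ∣ p ∣ + ∣ q ∣                               ∎
    where
    open ≤-Reasoning
    sub : ∀ {x} → x ∈ p ∪ q → x ∈ˡ elements p ++ elements q
    sub x∈ with x∈p∪q⁻ p q x∈
    ... | inj₁ x∈p = ∈-++⁺ˡ (∈-elements⁺ x∈p)
    ... | inj₂ x∈q = ∈-++⁺ʳ (elements p) (∈-elements⁺ x∈q)

  -- The last inequality limits the overshoot: `W` arises from `X` by adding one more set of size at
  -- most `a`.
  Straddle : Pred (Subset n) ℓ → ℕ → Set ℓ
  Straddle P a = ∃[ X ] ∃[ W ] P X × P W × X ⊆ W × ∣ X ∣ ≤ a × a < ∣ W ∣ × ∣ W ∣ ≤ ∣ X ∣ + a

  -- `X` is the union so far. The sets of the list are added until the size first exceeds `a`; this
  -- must happen, since after the last one `U ⊆ X` and `U` has more than `a` elements.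
  accumulate : {P : Pred (Subset n) ℓ} {a : ℕ} → (∀ {X Y} → P X → P Y → P (X ∪ Y)) →
    ∀ {U X} → a < ∣ U ∣ → P X → ∣ X ∣ ≤ a → ∀ {Ys} → All (λ Y → P Y × ∣ Y ∣ ≤ a) Ys →
    (∀ {v} → v ∈ U → v ∈ X ⊎ Any (v ∈_) Ys) → Straddle P a
  accumulate ∪-closed {U} {X} a<U PX X≤a [] covered =
    contradiction (≤-trans (p⊆q⇒∣p∣≤∣q∣ (λ v∈ → [ id , (λ ()) ]′ (covered v∈))) X≤a) (<⇒≱ a<U)
  accumulate {a = a} ∪-closed {U} {X} a<U PX X≤a {Y ∷ Ys} ((PY , Y≤a) ∷ PYs) covered with a <? ∣ X ∪ Y ∣
  ... | yes a<X∪Y = X , X ∪ Y , PX , ∪-closed PX PY , p⊆p∪q Y , X≤a , a<X∪Y ,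
    ≤-trans (∣p∪q∣≤∣p∣+∣q∣ X Y) (+-monoʳ-≤ ∣ X ∣ Y≤a)
  ... | no  a≮X∪Y = accumulate ∪-closed a<U (∪-closed PX PY) (≮⇒≥ a≮X∪Y) PYs regroup
    where
    regroup : ∀ {v} → v ∈ U → v ∈ X ∪ Y ⊎ Any (v ∈_) Ys
    regroup v∈ with covered v∈
    ... | inj₁ v∈X         = inj₁ (x∈p∪q⁺ (inj₁ v∈X))
    ... | inj₂ (here v∈Y)  = inj₁ (x∈p∪q⁺ (inj₂ v∈Y))
    ... | inj₂ (there v∈Y) = inj₂ v∈Y

  -- For a = ⌊δ/2⌋ and e the remainder this is ⌊δ²/4⌋ + δ.
  bagBound : ℕ → ℕ → ℕ
  bagBound a e = a * (e + a) + (e + 2 * a)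

  private
    shift : ∀ a r j → suc a + r + j ≡ suc (r + j) + a
    shift = solve-∀
    -- In these identities `suc (r + j)` is `p` and `suc (r + j) + i` is `a`, so that all
    -- differences become sums; `k`, `l` and `q` are chosen to meet their constraints with equality.
    k-exact : ∀ e i j r → suc (suc (i + (i + j + r + e))) + suc (r + j) ≡ suc (e + 2 * (suc (r + j) + i))
    k-exact = solve-∀
    l-exact : ∀ e i j r → suc (e + i + j) + (suc (suc (r + j) + i) + r) ≡ suc (e + 2 * (suc (r + j) + i))
    l-exact = solve-∀
    q-exact : ∀ i j r → suc (i + r) + suc (r + j) ≡ suc (suc (r + j) + i) + r
    q-exact = solve-∀
    surplus : ∀ e i j r → let a = suc (r + j) + i in
      a * (e + a) + (e + 2 * a) + (e * r + (i + j) * r + i * j) ≡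
      suc (r + j) * suc (suc (i + (i + j + r + e))) + suc (i + r) * suc (e + i + j)
    surplus = solve-∀

  -- With p + i = a, w = a + 1 + r and w + j = p + a, the first cut contributes
  -- p (δ + 1 - p) and the second at least (w - p) (δ + 1 - w), and the surplus
  -- over the bound is e r + (i + j) r + i j.
  cut-arithmetic : ∀ {a p w} e → p ≤ a → a < w → w ≤ p + a →
    ∃[ k ] ∃[ l ] ∃[ q ] k + p ≤ suc (e + 2 * a) × l + w ≤ suc (e + 2 * a) × q + p ≤ w ×
      bagBound a e ≤ p * k + q * l
  cut-arithmetic {a} {p} {w} e p≤a a<w w≤p+a
    with i , p+i≡a ← m≤n⇒∃[o]m+o≡n p≤a
       | r , a+1+r≡w ← m≤n⇒∃[o]m+o≡n a<w
       | j , w+j≡p+a ← m≤n⇒∃[o]m+o≡n w≤p+a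
    with refl ← +-cancelʳ-≡ a p (suc (r + j))
                  (trans (sym w+j≡p+a) (trans (cong (_+ j) (sym a+1+r≡w)) (shift a r j)))
    with refl ← p+i≡a with refl ← a+1+r≡w =
    suc (suc (i + (i + j + r + e))) , suc (e + i + j) , suc (i + r) ,
    ≤-reflexive (k-exact e i j r) , ≤-reflexive (l-exact e i j r) , ≤-reflexive (q-exact i j r) ,
    ≤-trans (m≤m+n _ (e * r + (i + j) * r + i * j)) (≤-reflexive (surplus e i j r))

  -- Bags of a tree decomposition of the line graph

  module _ (G : Graph n) where

    Incident : Fin n → Fin (length (edges G)) → Set
    Incident v i = EndpointOf v (lookup (edges G) i)

    incident? : ∀ v → Decidable (Incident v)
    incident? v i with lookup (edges G) i
    ... | x , y = (v ≟ x) ⊎-dec (v ≟ y)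

    Joins⇒Incidentˡ : ∀ {u v i} → Joins G (u , v) i → Incident u i
    Joins⇒Incidentˡ (inj₁ eq) = inj₁ (cong proj₁ (sym eq))
    Joins⇒Incidentˡ (inj₂ eq) = inj₂ (cong proj₂ (sym eq))

    Joins⇒Incidentʳ : ∀ {u v i} → Joins G (u , v) i → Incident v i
    Joins⇒Incidentʳ (inj₁ eq) = inj₂ (cong proj₂ (sym eq))
    Joins⇒Incidentʳ (inj₂ eq) = inj₁ (cong proj₁ (sym eq))

    -- An edge leaving the union leaves whichever part contains its inner end.
    ContainsCut-∪ : ∀ {B P Q} → ContainsCut G B P → ContainsCut G B Q → ContainsCut G B (P ∪ Q)
    ContainsCut-∪ {P = P} {Q} cutP cutQ u v i u∈ v∉ joins with x∈p∪q⁻ P Q u∈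
    ... | inj₁ u∈P = cutP u v i u∈P (v∉ ∘ x∈p∪q⁺ ∘ inj₁) joins
    ... | inj₂ u∈Q = cutQ u v i u∈Q (v∉ ∘ x∈p∪q⁺ ∘ inj₂) joins

    0<degree⇒incident : ∀ {v} → 0 < degree G v → ∃[ i ] Incident v i
    0<degree⇒incident {v} 0<deg with nonempty? (neighbours G v)
    ... | yes (u , u∈) with i , joins ← adjacent⇒joined G (∈-comprehension⁻ (adj? G v) u∈) =
      i , Joins⇒Incidentˡ joins
    ... | no  empty    = contradiction (trans (cong ∣_∣ (Empty-unique empty)) (∣⊥∣≡0 n)) (>⇒≢ 0<deg)

    module _ (D : TreeDecomposition (lineGraph G)) {ns} (R : Rooting (TreeDecomposition.tree D) ns)
             (all∈ : ∀ x → x ∈ˡ ns) where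

      open TreeDecomposition D
      open Rooting R using (above)
      open RootedTree R all∈

      -- Edges at `v` are pairwise adjacent in the line graph, so their subtrees meet pairwise and
      -- `helly` applies; positive degree makes the family nonempty.
      vertex-home : ∀ {v} → 0 < degree G v → ∃[ x ] (∀ {i} → Incident v i → i ∈ bag x)
      vertex-home {v} 0<deg with i₀ , i₀∋v ← 0<degree⇒incident 0<deg =
        map₂ (λ inAll {i} i∋v → inAll (∈-filter⁺ (incident? v) (∈-allFin i) i∋v))
          (helly {P = λ i x → i ∈ bag x} subtree (λ i x → i ∈? bag x) coversVertex
            (∈-filter⁺ (incident? v) (∈-allFin i₀) i₀∋v) meet)
        where
        incidence : List (Fin (length (edges G)))
        incidence = filter (incident? v) (allFin _)
        at-v : ∀ {i} → i ∈ˡ incidence → Incident v i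
        at-v i∈ = proj₂ (∈-filter⁻ (incident? v) {xs = allFin _} i∈)
        meet : ∀ {i j} → i ∈ˡ incidence → j ∈ˡ incidence → ∃[ x ] i ∈ bag x × j ∈ bag x
        meet {i} {j} i∈ j∈ with i ≟ j
        ... | no i≢j = coversEdge (i≢j , v , at-v i∈ , at-v j∈)
        -- An edge is not adjacent to itself in the line graph, so `coversVertex` supplies the node.
        ... | yes refl with x , i∈x ← coversVertex i = x , i∈x , i∈x

      module _ (home : Fin n → Fin order) (home-bag : ∀ v {i} → Incident v i → i ∈ bag (home v)) where

        -- The edge lies in the bags at `home u` and `home v`, which are separated by the tree edge
        -- from `c` to `x`; its subtree therefore contains `x`.
        below-cut : ∀ {c x} → c ChildOf x → ContainsCut G (bag x) (below home c)
        below-cut {c} {x} c-child u v i u∈ v∉ joins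
          with y , i∈y , c-child′ ← crossing
                 (subtree i (home-bag u (Joins⇒Incidentˡ joins)) (home-bag v (Joins⇒Incidentʳ joins)))
                 (∈-comprehension⁻ (λ v → c ⊴? home v) u∈) (v∉ ∘ ∈-comprehension⁺ (λ v → c ⊴? home v)) =
          subst (λ y → i ∈ bag y) (∷-injectiveˡ (trans (sym c-child′) c-child)) i∈y

        singleton-cut : ∀ v → ContainsCut G (bag (home v)) ⁅ v ⁆
        singleton-cut v _ _ _ u∈ _ joins with refl ← x∈⁅y⁆⇒x≡y v u∈ = home-bag v (Joins⇒Incidentˡ joins)

        -- At a balanced node `x`, each vertex with home at or below `x` lies in the branch of a
        -- child or has its home at `x`. Branches have size at most `a` by balance, singletons
        -- because `0 < a`.
        straddling-cuts : ∀ {a} → 0 < a → a < n → ∃[ x ] Straddle (ContainsCut G (bag x)) a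
        straddling-cuts {a} 0<a a<n =
          map₂ (λ {x} (heavy , light) →
              accumulate {P = ContainsCut G (bag x)} ContainsCut-∪ heavy
                -- The accumulation starts from the empty set, which no edge leaves.
                (λ _ _ _ u∈ → ⊥-elim (∉⊥ u∈)) (≤-trans (≤-reflexive (∣⊥∣≡0 n)) z≤n)
                (parts-good light) (inj₂ ∘ covered))
            (balancedNode home a<n)
          where
          child? : ∀ x → Decidable (_ChildOf x)
          child? x c = ≡-dec _≟_ (above c) (x ∷ above x)
          at? : ∀ x → Decidable (λ v → home v ≡ x)
          at? x v = home v ≟ x
          parts : Fin order → List (Subset n)
          parts x = map (below home) (filter (child? x) (allFin _)) ++ map ⁅_⁆ (filter (at? x) (allFin n))
          parts-good : ∀ {x} → (∀ {c} → c ChildOf x → ∣ below home c ∣ ≤ a) →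
            All (λ P → ContainsCut G (bag x) P × ∣ P ∣ ≤ a) (parts x)
          parts-good {x} light = All.++⁺
            (All.map⁺ {f = below home} (All.map
              (λ c-child → below-cut c-child , light c-child)
              (All.all-filter (child? x) (allFin _))))
            (All.map⁺ {f = ⁅_⁆} (All.map
              (λ { {v} refl → singleton-cut v , ≤-trans (≤-reflexive (∣⁅x⁆∣≡1 v)) 0<a })
              (All.all-filter (at? x) (allFin n))))
          covered : ∀ {x v} → v ∈ below home x → Any (v ∈_) (parts x)
          covered {x} {v} v∈ with ∈-comprehension⁻ (λ v → x ⊴? home v) v∈
          ... | here refl = Any.++⁺ʳ _ (Any.map⁺ (lose (∈-filter⁺ (at? x) (∈-allFin v) refl) (x∈⁅x⁆ v)))
          ... | there x∈  with c , c-child , c⊴ ← above-child refl x∈ =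
            Any.++⁺ˡ (Any.map⁺ (lose (∈-filter⁺ (child? x) (∈-allFin c) c-child)
              (∈-comprehension⁺ (λ v → c ⊴? home v) c⊴)))

    straddle-bound : ∀ {B a e} → (∀ u → e + 2 * a ≤ degree G u) → Straddle (ContainsCut G B) a →
      bagBound a e ≤ ∣ B ∣
    straddle-bound {B} {a} {e} δ≤ (X , W , cutX , cutW , X⊆W , X≤a , a<W , W≤)
      with k , l , q , k+X≤ , l+W≤ , q+X≤ , bound ← cut-arithmetic e X≤a a<W W≤ =
      ≤-trans bound (two-cuts-bound G {B = B} X⊆W cutX cutW δ≤ k+X≤ l+W≤ q+X≤)

    -- `0 < e + a` makes all degrees positive, so every vertex has a home; and `a < n` since `a` is
    -- at most any degree.
    bag-bound : (D : TreeDecomposition (lineGraph G)) → Fin n → ∀ a {e} → 0 < e + a →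
      (∀ u → e + 2 * a ≤ degree G u) →
      ∃[ x ] bagBound a e ≤ ∣ TreeDecomposition.bag D x ∣
    bag-bound D v a {e} 0<e+a δ≤ with ns , all∈ , R ← rooting (TreeDecomposition.isTree D) =
      choose a refl
      where
      open TreeDecomposition D
      a≤δ : a ≤ e + 2 * a
      a≤δ = ≤-trans (m≤m+n a (a + 0)) (m≤n+m (2 * a) e)
      homeAt : ∀ v → ∃[ x ] (∀ {i} → Incident v i → i ∈ bag x)
      homeAt v = vertex-home D R all∈ (≤-trans 0<e+a (≤-trans (+-monoʳ-≤ e (m≤m+n a (a + 0))) (δ≤ v)))
      home : Fin n → Fin order
      home v = proj₁ (homeAt v)
      home-bag : ∀ v {i} → Incident v i → i ∈ bag (home v)
      home-bag v = proj₂ (homeAt v)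
      -- The split is on a copy of `a`, so that both cases share the same `home`.
      choose : ∀ b → b ≡ a → ∃[ x ] bagBound b e ≤ ∣ bag x ∣
      -- No X and W straddle a = 0, but the cut around one vertex has δ edges.
      choose zero refl = home v , (begin
        e + 0                  ≡⟨ trans (+-identityʳ e) (sym (*-identityˡ e)) ⟩
        1 * e                  ≤⟨ m≤n+m (1 * e) (∣ ⊥ {n} ∣ * 0) ⟩
        ∣ ⊥ {n} ∣ * 0 + 1 * e  ≤⟨ two-cuts-bound G {B = bag (home v)} ⊥⊆
                                    (λ _ _ _ u∈ → ⊥-elim (∉⊥ u∈))
                                    (singleton-cut D R all∈ home home-bag v)
                                    δ≤ ∣⊥∣≤ e+∣v∣≤ 1+∣⊥∣≤ ⟩
        ∣ bag (home v) ∣       ∎)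
        where
        open ≤-Reasoning
        ∣⊥∣≤ : ∣ ⊥ {n} ∣ ≤ suc (e + 0)
        ∣⊥∣≤ = ≤-trans (≤-reflexive (∣⊥∣≡0 n)) z≤n
        e+∣v∣≤ : e + ∣ ⁅ v ⁆ ∣ ≤ suc (e + 0)
        e+∣v∣≤ = ≤-reflexive (trans (cong (e +_) (∣⁅x⁆∣≡1 v)) (+-suc e 0))
        1+∣⊥∣≤ : 1 + ∣ ⊥ {n} ∣ ≤ ∣ ⁅ v ⁆ ∣
        1+∣⊥∣≤ = ≤-reflexive (trans (cong suc (∣⊥∣≡0 n)) (sym (∣⁅x⁆∣≡1 v)))
      choose (suc _) refl = map₂ (straddle-bound δ≤)
        (straddling-cuts D R all∈ home home-bag (s≤s z≤n)
          (≤-<-trans (≤-trans a≤δ (δ≤ v)) (degree<n G v)))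

    max-bag-bound : (D : TreeDecomposition (lineGraph G)) → Fin n → ∀ a e →
      (∀ u → e + 2 * a ≤ degree G u) →
      bagBound a e ≤ max 0 (tabulate λ x → ∣ TreeDecomposition.bag D x ∣)
    max-bag-bound D v a e δ≤ with e + a in eq
    -- Here degrees may be zero, out of reach of `vertex-home`, but `bagBound 0 0` is 0.
    ... | zero  with refl ← m+n≡0⇒m≡0 e eq | refl ← m+n≡0⇒n≡0 e eq = z≤n
    ... | suc s with x , bound ← bag-bound D v a (subst (0 <_) (sym eq) (s≤s z≤n)) δ≤ rewrite eq =
      ≤-trans bound (All.lookup (xs≤max 0 _) (∈-tabulate⁺ x))

open TreesAndCuts using (bagBound; max-bag-bound)

open import Data.Integer.Base as ℤ using (ℤ; +_)
open import Data.Rational.Base using (_/_; _+_; _-_; _*_; _≥_; 1ℚ)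

open import Data.Fin.Subset using (∣_∣)
open import Data.Integer.Base using (1ℤ; -1ℤ)
import Data.Integer.Properties as ℤ
open import Data.Integer.Tactic.RingSolver using (solve-∀)
open import Data.List.Extrema.Nat using (min≤xs)
open import Data.List.Membership.Propositional.Properties using (∈-tabulate⁺)
import Data.Nat.Base as ℕ
open import Data.Nat.Divisibility using (divides; ∣m+n∣m⇒∣n; ∣⇒≤)
import Data.Nat.Properties as ℕ
open import Data.Rational.Base using (ℚ; _≤_; -_; toℚᵘ)
import Data.Rational.Properties as ℚ
open import Data.Rational.Unnormalised.Base as ℚᵘ using (ℚᵘ; mkℚᵘ; _≃_; *≤*; *≡*)
import Data.Rational.Unnormalised.Properties as ℚᵘ

-- Arithmetic of the bound

toℚᵘ-integer : ∀ z → toℚᵘ (z / 1) ≃ mkℚᵘ z 0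
toℚᵘ-integer z = ℚ.toℚᵘ-fromℚᵘ (mkℚᵘ z 0)

-- Over unnormalised rationals an equation unfolds to an integer polynomial identity, which the ring
-- solver can prove.
quadraticᵘ : ℤ → ℚᵘ → ℚᵘ
quadraticᵘ d c = mkℚᵘ (+ 1) 3 ℚᵘ.* (mkℚᵘ d 0 ℚᵘ.* mkℚᵘ d 0) ℚᵘ.+ mkℚᵘ d 0 ℚᵘ.- c

toℚᵘ-quadratic : ∀ z c → toℚᵘ ((+ 1 / 4) * ((z / 1) * (z / 1)) + (z / 1) - c) ≃ quadraticᵘ z (toℚᵘ c)
toℚᵘ-quadratic z c = begin-equality
  toℚᵘ ((+ 1 / 4) * (q * q) + q - c)
    ≃⟨ ℚ.toℚᵘ-homo-+ ((+ 1 / 4) * (q * q) + q) (- c) ⟩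
  toℚᵘ ((+ 1 / 4) * (q * q) + q) ℚᵘ.+ toℚᵘ (- c)
    ≃⟨ ℚᵘ.+-cong (ℚ.toℚᵘ-homo-+ ((+ 1 / 4) * (q * q)) q) (ℚ.toℚᵘ-homo‿- c) ⟩
  toℚᵘ ((+ 1 / 4) * (q * q)) ℚᵘ.+ toℚᵘ q ℚᵘ.- toℚᵘ c
    ≃⟨ ℚᵘ.+-congˡ (ℚᵘ.- toℚᵘ c) (ℚᵘ.+-cong (ℚ.toℚᵘ-homo-* (+ 1 / 4) (q * q)) (toℚᵘ-integer z)) ⟩
  mkℚᵘ (+ 1) 3 ℚᵘ.* toℚᵘ (q * q) ℚᵘ.+ mkℚᵘ z 0 ℚᵘ.- toℚᵘ c
    ≃⟨ ℚᵘ.+-congˡ (ℚᵘ.- toℚᵘ c) (ℚᵘ.+-congˡ (mkℚᵘ z 0) (ℚᵘ.*-congˡ {mkℚᵘ (+ 1) 3}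
         (ℚᵘ.≃-trans (ℚ.toℚᵘ-homo-* q q) (ℚᵘ.*-cong (toℚᵘ-integer z) (toℚᵘ-integer z))))) ⟩
  mkℚᵘ (+ 1) 3 ℚᵘ.* (mkℚᵘ z 0 ℚᵘ.* mkℚᵘ z 0) ℚᵘ.+ mkℚᵘ z 0 ℚᵘ.- toℚᵘ c
    ∎
  where
  open ℚᵘ.≤-Reasoning
  q : ℚ
  q = z / 1

-- `K` is the lower bound on the largest bag size `M`; both are lowered by one to become widths.
quadratic-bound : ∀ d c {K M} →
  quadraticᵘ d (toℚᵘ c) ≃ mkℚᵘ (+ K ℤ.- 1ℤ) 0 → K ℕ.≤ M →
  (+ 1 / 4) * ((d / 1) * (d / 1)) + (d / 1) - c ≤ (+ M ℤ.- 1ℤ) / 1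
quadratic-bound d c {K} {M} eq K≤M = ℚ.toℚᵘ-cancel-≤ (begin
  toℚᵘ ((+ 1 / 4) * ((d / 1) * (d / 1)) + (d / 1) - c)
    ≃⟨ toℚᵘ-quadratic d c ⟩
  quadraticᵘ d (toℚᵘ c)
    ≃⟨ eq ⟩
  mkℚᵘ (+ K ℤ.- 1ℤ) 0
    ≤⟨ *≤* (ℤ.*-monoʳ-≤-nonNeg (+ 1) (ℤ.+-monoˡ-≤ -1ℤ (ℤ.+≤+ K≤M))) ⟩
  mkℚᵘ (+ M ℤ.- 1ℤ) 0
    ≃⟨ toℚᵘ-integer (+ M ℤ.- 1ℤ) ⟨
  toℚᵘ ((+ M ℤ.- 1ℤ) / 1)
    ∎)
  where open ℚᵘ.≤-Reasoning

private
  -- Cross-multiplied forms of the two equations below; 4 and 16 are the denominators of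
  -- `quadraticᵘ` for `c` equal to 1 and 5/4, formed without cancellation.
  even-numerator : ∀ x → let d = + 2 ℤ.* x in
    (((+ 1) ℤ.* (d ℤ.* d) ℤ.* + 1 ℤ.+ d ℤ.* + 4) ℤ.* + 1 ℤ.+ -1ℤ ℤ.* + 4) ℤ.* + 1 ≡
    (x ℤ.* x ℤ.+ d ℤ.- 1ℤ) ℤ.* + 4
  even-numerator = solve-∀
  odd-numerator : ∀ x → let d = + 1 ℤ.+ + 2 ℤ.* x in
    (((+ 1) ℤ.* (d ℤ.* d) ℤ.* + 1 ℤ.+ d ℤ.* + 4) ℤ.* + 4 ℤ.+ (ℤ.- + 5) ℤ.* + 4) ℤ.* + 1 ≡
    (x ℤ.* (+ 1 ℤ.+ x) ℤ.+ d ℤ.- 1ℤ) ℤ.* + 16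
  odd-numerator = solve-∀

quadraticᵘ-even : ∀ x {d k} → d ≡ + 2 ℤ.* x → k ≡ x ℤ.* x ℤ.+ + 2 ℤ.* x →
  quadraticᵘ d (toℚᵘ 1ℚ) ≃ mkℚᵘ (k ℤ.- 1ℤ) 0
quadraticᵘ-even x refl refl = *≡* (even-numerator x)

quadraticᵘ-odd : ∀ x {d k} → d ≡ + 1 ℤ.+ + 2 ℤ.* x → k ≡ x ℤ.* (+ 1 ℤ.+ x) ℤ.+ (+ 1 ℤ.+ + 2 ℤ.* x) →
  quadraticᵘ d (toℚᵘ (+ 5 / 4)) ≃ mkℚᵘ (k ℤ.- 1ℤ) 0
quadraticᵘ-odd x refl refl = *≡* (odd-numerator x)

pos-bagBound : ∀ a e → + bagBound a e ≡ + a ℤ.* + (e ℕ.+ a) ℤ.+ (+ e ℤ.+ + 2 ℤ.* + a)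
pos-bagBound a e = cong₂ ℤ._+_ (ℤ.pos-* a (e ℕ.+ a)) (cong (ℤ._+_ (+ e)) (ℤ.pos-* 2 a))

even⊎odd : ∀ m → ∃[ a ] (m ≡ 2 ℕ.* a ⊎ m ≡ 1 ℕ.+ 2 ℕ.* a)
even⊎odd 0 = 0 , inj₁ refl
even⊎odd (suc m) with even⊎odd m
... | a , inj₁ m≡2a   = a , inj₂ (cong suc m≡2a)
... | a , inj₂ m≡1+2a = suc a , inj₁ (trans (cong suc m≡1+2a) (cong suc (sym (ℕ.+-suc a (a ℕ.+ 0)))))

minDegree≤degree : ∀ {n} (G : Graph (suc n)) u → minDegree G ℕ.≤ degree G u
minDegree≤degree G u =
  All.lookup (min≤xs (degree G zero) (tabulate (degree G))) (∈-tabulate⁺ {f = degree G} u)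

-- Writing `δ` as `e + 2a` with `e` equal to 0 or 1, the required quadratic is exactly
-- `bagBound a e` minus one, namely a² + 2a - 1 or a² + 3a.
parity-bounds : ∀ δ M → (∀ a e → δ ≡ e ℕ.+ 2 ℕ.* a → bagBound a e ℕ.≤ M) →
  let δℚ = + δ / 1
      tw = + M ℤ.- 1ℤ
  in (2 ∣ δ → tw / 1 ≥ (+ 1 / 4) * (δℚ * δℚ) + δℚ - 1ℚ)
     × (2 ∤ δ → tw / 1 ≥ (+ 1 / 4) * (δℚ * δℚ) + δℚ - (+ 5 / 4))
parity-bounds δ M bound with even⊎odd δ
... | a , inj₁ refl =
  (λ _ → quadratic-bound (+ δ) 1ℚ
    (quadraticᵘ-even (+ a) (ℤ.pos-* 2 a)
      (trans (pos-bagBound a 0) (cong (ℤ._+_ (+ a ℤ.* + a)) (ℤ.+-identityˡ _))))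
    (bound a 0 refl)) ,
  (λ 2∤δ → contradiction (divides a (ℕ.*-comm 2 a)) 2∤δ)
... | a , inj₂ refl =
  (λ 2∣δ → contradiction
    (∣⇒≤ (∣m+n∣m⇒∣n (subst (2 ∣_) (ℕ.+-comm 1 (2 ℕ.* a)) 2∣δ) (divides a (ℕ.*-comm 2 a))))
    (ℕ.<⇒≱ (ℕ.s≤s (ℕ.s≤s ℕ.z≤n)))) ,
  (λ _ → quadratic-bound (+ δ) (+ 5 / 4)
    (quadraticᵘ-odd (+ a) (cong (ℤ._+_ (+ 1)) (ℤ.pos-* 2 a)) (pos-bagBound a 1))
    (bound a 1 refl))

theorem1p2 : ∀ {n : ℕ} (G : Graph (suc n)) (pw tw : ℤ) →
    IsPathwidth (lineGraph G) pw → IsTreewidth (lineGraph G) tw →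
    let δ = minDegree G
        δℚ = + δ / 1
    in pw ℤ.≥ tw
       × (2 ∣ δ → tw / 1 ≥ (+ 1 / 4) * (δℚ * δℚ) + δℚ - 1ℚ)
       × (2 ∤ δ → tw / 1 ≥ (+ 1 / 4) * (δℚ * δℚ) + δℚ - (+ 5 / 4))
theorem1p2 G pw tw ((P , _ , width-P) , _) ((D , refl) , tw-least) =
  -- A path decomposition is in particular a tree decomposition, so `pw` competes in the minimum
  -- defining `tw`.
  tw-least pw (P , width-P) ,
  parity-bounds (minDegree G) (max 0 (tabulate λ x → ∣ TreeDecomposition.bag D x ∣)) λ a e δ≡ →
    max-bag-bound G D zero a e λ u → subst (ℕ._≤ degree G u) δ≡ (minDegree≤degree G u)
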